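{- Let $G$ be a finite simple graph that contains none of $C_4$, $\overline{C_4}$, $S_3$, the chair and the co-chair as an induced subgraph. Then every (finite) oriented graph $D$ missing $G$ has a vertex $v$ with $d^{+}_D(v)\le d^{++}_D(v)$ (i.e. $D$ satisfies Seymour's Second Neighborhood Conjecture).
   Context: An oriented graph is a digraph with no loops, no parallel arcs and no directed cycles of length 2. For a vertex $v$ of an oriented graph $D$, $N^+_D(v)$ is its set of out-neighbours, $N^{++}_D(v)=\{x\in V(D)\setminus N^+_D(v): \exists y\in N^+_D(v),\ (y,x)\in E(D)\}$ is its second out-neighbourhood, $d^+_D(v)=|N^+_D(v)|$ and $d^{++}_D(v)=|N^{++}_D(v)|$. A missing edge of $D$ is a pair $\{x,y\}$ of distinct vertices such that neither $(x,y)$ nor $(y,x)$ is an arc. The missing graph of $D$ is the graph whose edges are the missing edges of $D$ and whose vertices are the vertices incident to at least one missing edge; $D$ is said to be missing $G$ if its missing graph is (isomorphic to) $G$. $C_n$ denotes the cycle on $n$ vertices and $\overline{H}$ the complement of $H$. The chair is the graph with vertex set $\{x,y,z,t,v\}$ and edge set $\{xy,yz,zt,zv\}$; the co-chair is its complement. $S_3$ is the 3-sun: the graph on vertices $a,b,c,p,q,r$ with edges $ab,bc,ca,pa,pb,qb,qc,ra,rc$ (a triangle $abc$ plus three vertices of degree 2, each adjacent to a different pair of triangle vertices). -}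

module Defs where

open import Data.Nat using (ℕ; zero; suc; _+_; _≤_)
open import Data.Fin using (Fin; zero; suc; _≟_)
open import Data.Fin using (#_)
open import Data.Bool using (Bool; true; false; not; _∧_; _∨_; if_then_else_)
open import Data.Product using (Σ; ∃; _×_; _,_)
open import Data.List using (List; []; _∷_)
open import Relation.Nullary.Decidable using (⌊_⌋)
open import Relation.Binary.PropositionalEquality using (_≡_)
open import Function.Definitions using (Injective)

count : ∀ {n} → (Fin n → Bool) → ℕ
count {zero}  f = 0
count {suc n} f = (if f zero then 1 else 0) + count (λ i → f (suc i))

anyFin : ∀ {n} → (Fin n → Bool) → Bool
anyFin {zero}  f = false
anyFin {suc n} f = f zero ∨ anyFin (λ i → f (suc i))

eqᵇ : ∀ {n} → Fin n → Fin n → Bool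
eqᵇ i j = ⌊ i ≟ j ⌋

Graph : ℕ → Set
Graph n = Fin n → Fin n → Bool

record IsSimple {n : ℕ} (g : Graph n) : Set where
  field
    irrefl : ∀ i → g i i ≡ false
    sym    : ∀ i j → g i j ≡ g j i

complement : ∀ {n} → Graph n → Graph n
complement g i j = not (eqᵇ i j) ∧ not (g i j)

InducedSub : ∀ {k n} → Graph k → Graph n → Set
InducedSub {k} {n} h g =
  Σ (Fin k → Fin n) λ f → Injective _≡_ _≡_ f × (∀ i j → h i j ≡ g (f i) (f j))

fromEdges : ∀ {n} → List (Fin n × Fin n) → Graph n
fromEdges []             i j = false
fromEdges ((a , b) ∷ es) i j =
  (eqᵇ i a ∧ eqᵇ j b) ∨ (eqᵇ i b ∧ eqᵇ j a) ∨ fromEdges es i j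

C4 : Graph 4
C4 = fromEdges ((# 0 , # 1) ∷ (# 1 , # 2) ∷ (# 2 , # 3) ∷ (# 3 , # 0) ∷ [])

chair : Graph 5
chair = fromEdges ((# 0 , # 1) ∷ (# 1 , # 2) ∷ (# 2 , # 3) ∷ (# 2 , # 4) ∷ [])

S3 : Graph 6
S3 = fromEdges ((# 0 , # 1) ∷ (# 1 , # 2) ∷ (# 2 , # 0) ∷ (# 3 , # 0) ∷ (# 3 , # 1) ∷
                (# 4 , # 1) ∷ (# 4 , # 2) ∷ (# 5 , # 0) ∷ (# 5 , # 2) ∷ [])

Digraph : ℕ → Set
Digraph m = Fin m → Fin m → Bool

record IsOriented {m : ℕ} (d : Digraph m) : Set where
  field
    noLoop    : ∀ x → d x x ≡ false
    no2cycle  : ∀ x y → d x y ≡ true → d y x ≡ false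

outdeg : ∀ {m} → Digraph m → Fin m → ℕ
outdeg d v = count (λ x → d v x)

inSecondOut : ∀ {m} → Digraph m → Fin m → Fin m → Bool
inSecondOut d v x = not (d v x) ∧ anyFin (λ y → d v y ∧ d y x)

secondOutdeg : ∀ {m} → Digraph m → Fin m → ℕ
secondOutdeg d v = count (inSecondOut d v)

missingᵇ : ∀ {m} → Digraph m → Fin m → Fin m → Bool
missingᵇ d x y = not (eqᵇ x y) ∧ not (d x y) ∧ not (d y x)

-- d is missing g: the missing graph of d (vertices = those incident to a
-- missing edge, edges = missing edges) is isomorphic to g.  Concretely: an
-- injection f from the vertices of g onto exactly the vertices incident to
-- a missing edge, such that adjacency in g corresponds to missing edges.
MissingGraph : ∀ {m n} → Digraph m → Graph n → Set
MissingGraph {m} {n} d g =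
  Σ (Fin n → Fin m) λ f →
    Injective _≡_ _≡_ f ×
    (∀ i j → g i j ≡ missingᵇ d (f i) (f j)) ×
    (∀ x y → missingᵇ d x y ≡ true → ∃ λ i → f i ≡ x)

{-# OPTIONS --safe #-}

-- For missing edges ab and uv, say that (a , b) loses to (u , v) if a → u and b → v, while v
-- cannot be reached from a, nor u from b, by a path of length at most two.  Under the hypotheses
-- ab and uv are then the end edges of an induced path on four vertices of the missing graph,
-- every other vertex is adjacent to both or neither of its ends and to both or neither of its
-- middles, and losing is a partial injection.  Its orbits are paths, or the cycle formed by the
-- edges of a C₅, so the missing edges can be oriented consistently along them, starting from an
-- orientation u → v of the first edge for which no arc w → u makes v a new second out-neighbour.
-- Take the feed f of a median order of the resulting tournament, and turn the missing edges at f
-- towards f except those f → y where (f , y) loses.  The feed satisfies the conjecture in this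
-- tournament, and its new second out-neighbours are paid for by its new out-neighbours.

module Submission where

open import Defs
open import Data.Bool using (Bool; true; false; not; _∧_; _∨_; if_then_else_)
open import Data.Bool.Properties as Bool using (∨-zeroʳ; ¬-not; not-¬)
open import Data.Fin using (Fin; zero; suc; toℕ; _≟_)
open import Data.Fin.Properties using (any?; all?; suc-injective; toℕ-injective)
open import Data.List using (List; []; _∷_; _++_; [_]; map; length; allFin; tabulate)
open import Data.List.Properties using (++-assoc; map-tabulate)
open import Data.List.Relation.Binary.Permutation.Propositional using (_↭_; ↭-refl; ↭-sym; ↭-trans; prep)
open import Data.List.Relation.Binary.Permutation.Propositional.Properties using (map⁺; shift; ↭-length; ↭-empty-inv)
open import Data.List.Membership.Propositional using (_∈_)
open import Data.List.Membership.Propositional.Properties using (∈-allFin)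
open import Data.List.Relation.Unary.All as All using (All; []; _∷_)
open import Data.List.Relation.Unary.All.Properties using (∷ʳ⁺)
open import Data.Nat using (ℕ; zero; suc; _+_; _*_; _≤_; _<_; _<ᵇ_; _≤?_; z≤n; s≤s)
open import Data.Nat.ListAction using (sum)
open import Data.Nat.ListAction.Properties using (sum-↭)
open import Data.Nat.Properties
  using (≤-refl; ≤-reflexive; ≤-trans; <⇒≱; ≰⇒>; n≤1+n; m≤n+m; m≤m+n;
         +-mono-≤; +-monoˡ-<; +-monoʳ-<; +-monoʳ-≤; +-cancelʳ-≤; +-suc; +-identityʳ; +-assoc; *-monoʳ-≤; module ≤-Reasoning)
open import Data.Nat.Solver using (module +-*-Solver)
open import Data.Product using (∃; ∃₂; _×_; _,_; proj₁; proj₂)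
open import Data.Sum using (_⊎_; inj₁; inj₂; [_,_]′)
open import Data.Unit using (⊤; tt)
open import Data.Empty using (⊥; ⊥-elim)
open import Data.Vec using (Vec; []; _∷_; lookup)
open import Function using (_∘_; id; flip; case_of_)
open import Function.Definitions using (Injective)
open import Relation.Nullary using (¬_; Dec; does; yes; no; contradiction; ¬?; _×-dec_; _→-dec_)
open import Relation.Nullary.Decidable using (decidable-stable; from-yes; dec-true; dec-false; ⌊_⌋; map′)
open import Relation.Binary.PropositionalEquality using (_≡_; _≢_; refl; sym; trans; cong; cong₂; subst; subst₂; ≢-sym)

-- Counting

𝟙 : Bool → ℕ
𝟙 b = if b then 1 else 0

tally : {A : Set} → (A → Bool) → List A → ℕ
tally p xs = sum (map (𝟙 ∘ p) xs)

tally-↭ : {A : Set} (p : A → Bool) {xs ys : List A} → xs ↭ ys → tally p xs ≡ tally p ys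
tally-↭ p = sum-↭ ∘ map⁺ (𝟙 ∘ p)

𝟙-mono : ∀ {a b} → (a ≡ true → b ≡ true) → 𝟙 a ≤ 𝟙 b
𝟙-mono {false} _ = z≤n
𝟙-mono {true}  f rewrite f refl = ≤-refl

𝟙-disjoint : ∀ {a b} → (a ≡ true → b ≡ false) → 𝟙 a + (𝟙 b + 0) ≤ 𝟙 (a ∨ b) + 0
𝟙-disjoint {false} _ = ≤-refl
𝟙-disjoint {true}  f rewrite f refl = ≤-refl

tally-mono : {A : Set} {p q : A → Bool} {xs : List A} →
  All (λ x → p x ≡ true → q x ≡ true) xs → tally p xs ≤ tally q xs
tally-mono []       = z≤n
tally-mono (f ∷ fs) = +-mono-≤ (𝟙-mono f) (tally-mono fs)

count≡tally : ∀ {n} (p : Fin n → Bool) → count p ≡ tally p (allFin n)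
count≡tally p = trans (go p) (cong sum (sym (map-tabulate id (𝟙 ∘ p))))
  where
  go : ∀ {n} (p : Fin n → Bool) → count p ≡ sum (tabulate (𝟙 ∘ p))
  go {zero}  p = refl
  go {suc n} p = cong (𝟙 (p zero) +_) (go (p ∘ suc))

counts : ∀ {n} → List (Fin n → Bool) → ℕ
counts ps = sum (map count ps)

-- Interchange of two sums: inequalities that hold at every point add up over the points, the
-- induction splitting off the point `zero`.
counts-mono : ∀ {n} (ps qs : List (Fin n → Bool)) →
  (∀ x → tally (λ p → p x) ps ≤ tally (λ q → q x) qs) → counts ps ≤ counts qs
counts-mono {zero}  ps qs h = ≤-trans (≤-reflexive (vanish ps)) z≤n
  where
  vanish : (ps : List (Fin 0 → Bool)) → counts ps ≡ 0
  vanish []       = refl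
  vanish (p ∷ ps) = vanish ps
counts-mono {suc n} ps qs h = begin
  counts ps                                        ≡⟨ split ps ⟩
  tally (λ p → p zero) ps + counts (map (_∘ suc) ps)
    ≤⟨ +-mono-≤ (h zero) (counts-mono (map (_∘ suc) ps) (map (_∘ suc) qs) tails) ⟩
  tally (λ q → q zero) qs + counts (map (_∘ suc) qs) ≡⟨ split qs ⟨
  counts qs                                        ∎
  where
  open ≤-Reasoning
  open +-*-Solver
  split : ∀ (ps : List (Fin (suc n) → Bool)) → counts ps ≡ tally (λ p → p zero) ps + counts (map (_∘ suc) ps)
  split []       = refl
  split (p ∷ ps) rewrite split ps =
    solve 4 (λ a b c d → (a :+ b) :+ (c :+ d) := (a :+ c) :+ (b :+ d)) refl (𝟙 (p zero)) (count (p ∘ suc)) _ _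
  shifted : ∀ (ps : List (Fin (suc n) → Bool)) x → tally (λ p → p x) (map (_∘ suc) ps) ≡ tally (λ p → p (suc x)) ps
  shifted []       x = refl
  shifted (p ∷ ps) x = cong (𝟙 (p (suc x)) +_) (shifted ps x)
  tails : ∀ x → tally (λ p → p x) (map (_∘ suc) ps) ≤ tally (λ q → q x) (map (_∘ suc) qs)
  tails x rewrite shifted ps x | shifted qs x = h (suc x)

count-≤ : ∀ {n} (p : Fin n → Bool) → count p ≤ n
count-≤ {zero}  p = z≤n
count-≤ {suc n} p with p zero
... | true  = s≤s (count-≤ (p ∘ suc))
... | false = ≤-trans (count-≤ (p ∘ suc)) (n≤1+n n)

count-strict : ∀ {n} {p q : Fin n → Bool} → (∀ x → p x ≡ true → q x ≡ true) →
  ∀ y → p y ≡ false → q y ≡ true → count p < count q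
count-strict {p = p} {q} p⇒q zero ¬py qy rewrite ¬py | qy =
  s≤s (≤-trans (≤-reflexive (count≡tally (p ∘ suc)))
    (≤-trans (tally-mono (All.tabulate {xs = allFin _} (λ {x} _ → p⇒q (suc x))))
      (≤-reflexive (sym (count≡tally (q ∘ suc))))))
count-strict {p = p} {q} p⇒q (suc y) ¬py qy = begin-strict
  𝟙 (p zero) + count (p ∘ suc) <⟨ +-monoʳ-< (𝟙 (p zero)) (count-strict (p⇒q ∘ suc) y ¬py qy) ⟩
  𝟙 (p zero) + count (q ∘ suc) ≤⟨ +-mono-≤ (𝟙-mono (p⇒q zero)) ≤-refl ⟩
  𝟙 (q zero) + count (q ∘ suc) ∎
  where open ≤-Reasoning

∧-true : ∀ {a b} → a ∧ b ≡ true → a ≡ true × b ≡ true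
∧-true {true} {true} _ = refl , refl

∨-true : ∀ {a b} → a ∨ b ≡ true → a ≡ true ⊎ b ≡ true
∨-true {true}  _ = inj₁ refl
∨-true {false} h = inj₂ h

∨-false : ∀ {a b} → a ∨ b ≡ false → a ≡ false × b ≡ false
∨-false {false} h = refl , h

anyFin-true : ∀ {n} (h : Fin n → Bool) i → h i ≡ true → anyFin h ≡ true
anyFin-true h zero    hi = cong (_∨ anyFin (h ∘ suc)) hi
anyFin-true h (suc i) hi = trans (cong (h zero ∨_) (anyFin-true (h ∘ suc) i hi)) (∨-zeroʳ (h zero))

-- Functionality of `F` makes the partners chosen in `q` distinct; the induction deletes the partner
-- of `zero` from `q`.
count-image : ∀ {n k} {p : Fin n → Bool} {q : Fin k → Bool} {F : Fin k → Fin n → Set} →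
  (∀ {y v v′} → F y v → F y v′ → v ≡ v′) →
  (∀ v → p v ≡ true → ∃ λ y → q y ≡ true × F y v) → count p ≤ count q
count-image {zero}          functional image = z≤n
count-image {suc n} {p = p} {q} {F} functional image with p zero in p₀
... | false = count-image {F = λ y v → F y (suc v)} (λ f f′ → suc-injective (functional f f′)) (image ∘ suc)
... | true with image zero p₀
...   | y , qy , Fy = ≤-trans (s≤s (count-image {q = q∖y} {F = λ z v → F z (suc v)}
          (λ f f′ → suc-injective (functional f f′)) image′))
          (count-strict {p = q∖y} {q} (λ x → proj₁ ∘ ∧-true) y removed qy)
  where
  q∖y : Fin _ → Bool
  q∖y z = q z ∧ not ⌊ z ≟ y ⌋
  removed : q∖y y ≡ false
  removed with y ≟ y
  ... | yes _   = Bool.∧-zeroʳ (q y)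
  ... | no  y≢y = contradiction refl y≢y
  image′ : ∀ v → p (suc v) ≡ true → ∃ λ z → q∖y z ≡ true × F z (suc v)
  image′ v pv with image (suc v) pv
  ... | z , qz , Fz with z ≟ y in eq
  ...   | yes refl = case functional Fy Fz of λ ()
  ...   | no  _    = z , trans (cong (λ d → q z ∧ not ⌊ d ⌋) eq) (trans (Bool.∧-identityʳ (q z)) qz) , Fz

-- Median orders, listed from the last vertex to the first

module MedianOrder {A : Set} (T : A → A → Bool) where

  -- The number of forward arcs: the list runs backwards, so `ys` are the vertices preceding `x`.
  score : List A → ℕ
  score []       = 0
  score (x ∷ ys) = tally (λ y → T y x) ys + score ys

  -- Moving `x` in front of the block `zs` that immediately precedes it trades the forward arcs from
  -- `zs` to `x` for those from `x` to `zs`; stability says that no such move raises the score.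
  Stable : A → List A → Set
  Stable x ys = ∀ zs ws → ys ≡ zs ++ ws → tally (T x) zs ≤ tally (λ z → T z x) zs

  data Median : List A → Set where
    []  : Median []
    _∷_ : ∀ {x ys} → Stable x ys → Median ys → Median (x ∷ ys)

  score-insert : ∀ x zs ws →
    score (zs ++ x ∷ ws) ≡ tally (T x) zs + (tally (λ w → T w x) ws + score (zs ++ ws))
  score-insert x []       ws = refl
  score-insert x (z ∷ zs) ws rewrite tally-↭ (λ y → T y z) (shift x zs ws) | score-insert x zs ws =
    solve 5 (λ a b c d e → (a :+ b) :+ (c :+ (d :+ e)) := (a :+ c) :+ (d :+ (b :+ e))) refl
      (𝟙 (T x z)) (tally (λ y → T y z) (zs ++ ws)) (tally (T x) zs) (tally (λ w → T w x) ws) (score (zs ++ ws))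
    where open +-*-Solver

  tally-++ : (p : A → Bool) (zs ws : List A) → tally p (zs ++ ws) ≡ tally p zs + tally p ws
  tally-++ p []       ws = refl
  tally-++ p (z ∷ zs) ws rewrite tally-++ p zs ws = sym (+-assoc (𝟙 (p z)) _ _)

  score-improves : ∀ x zs ws → tally (λ z → T z x) zs < tally (T x) zs →
    score (x ∷ zs ++ ws) < score (zs ++ x ∷ ws)
  score-improves x zs ws lt rewrite score-insert x zs ws | tally-++ (λ z → T z x) zs ws
    | +-assoc (tally (λ z → T z x) zs) (tally (λ z → T z x) ws) (score (zs ++ ws)) = +-monoˡ-< _ lt

  stable? : ∀ x ys → Stable x ys ⊎
    ∃₂ λ zs ws → ys ≡ zs ++ ws × tally (λ z → T z x) zs < tally (T x) zs
  stable? x ys = go 0 0 ys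
    where
    go : ∀ i o ys → (∀ zs ws → ys ≡ zs ++ ws → o + tally (T x) zs ≤ i + tally (λ z → T z x) zs) ⊎
      ∃₂ λ zs ws → ys ≡ zs ++ ws × i + tally (λ z → T z x) zs < o + tally (T x) zs
    go i o ys with o + 0 ≤? i + 0
    go i o ys       | no  o≰i = inj₂ ([] , ys , refl , ≰⇒> o≰i)
    go i o []       | yes o≤i = inj₁ λ { [] _ refl → o≤i }
    go i o (y ∷ ys) | yes o≤i with go (i + 𝟙 (T y x)) (o + 𝟙 (T x y)) ys
    ... | inj₁ h = inj₁ λ where
      []       _  _    → o≤i
      (z ∷ zs) ws refl → subst₂ _≤_ (+-assoc o _ _) (+-assoc i _ _) (h zs ws refl)
    ... | inj₂ (zs , ws , refl , lt) = inj₂ (y ∷ zs , ws , refl , subst₂ _<_ (+-assoc i _ _) (+-assoc o _ _) lt)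

  improve : ∀ xs → Median xs ⊎ ∃ λ xs′ → xs′ ↭ xs × score xs < score xs′
  improve []       = inj₁ []
  improve (x ∷ ys) with improve ys
  ... | inj₂ (ys′ , ρ , lt) = inj₂ (x ∷ ys′ , prep x ρ ,
          subst (λ t → t + score ys < _) (tally-↭ (λ y → T y x) ρ) (+-monoʳ-< (tally (λ y → T y x) ys′) lt))
  ... | inj₁ med with stable? x ys
  ...   | inj₁ st = inj₁ (st ∷ med)
  ...   | inj₂ (zs , ws , refl , lt) = inj₂ (zs ++ x ∷ ws , shift x zs ws , score-improves x zs ws lt)

  tally-≤ : (p : A → Bool) (xs : List A) → tally p xs ≤ length xs
  tally-≤ p []       = z≤n
  tally-≤ p (x ∷ xs) with p x
  ... | true  = s≤s (tally-≤ p xs)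
  ... | false = ≤-trans (tally-≤ p xs) (n≤1+n _)

  score-≤ : ∀ xs → score xs ≤ length xs * length xs
  score-≤ []       = z≤n
  score-≤ (x ∷ xs) = ≤-trans (+-mono-≤ (tally-≤ _ xs) (score-≤ xs))
    (*-monoʳ-≤ (suc (length xs)) (n≤1+n _))

  -- Each improvement raises the score, which is at most the square of the length; `k` bounds the
  -- improvements still possible.
  median : ∀ xs → ∃ λ xs′ → xs′ ↭ xs × Median xs′
  median xs = go (length xs * length xs) xs (m≤n+m _ _)
    where
    go : ∀ k xs → length xs * length xs ≤ score xs + k → ∃ λ xs′ → xs′ ↭ xs × Median xs′
    go k xs bound with improve xs
    ... | inj₁ med = xs , ↭-refl , med
    go zero xs bound | inj₂ (xs′ , ρ , lt) = contradiction
      (≤-trans (score-≤ xs′) (subst (λ l → l * l ≤ score xs) (sym (↭-length ρ)) (subst (_ ≤_) (+-identityʳ _) bound)))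
      (<⇒≱ lt)
    go (suc k) xs bound | inj₂ (xs′ , ρ , lt)
      with go k xs′ (subst (λ l → l * l ≤ _) (sym (↭-length ρ))
             (≤-trans bound (≤-trans (≤-reflexive (+-suc (score xs) k)) (+-mono-≤ lt ≤-refl))))
    ... | xs″ , ρ′ , med = xs″ , ↭-trans ρ′ ρ , med

  Dominates : (A → Bool) → A → Set
  Dominates p w = ∀ u → p u ≡ true → T w u ≡ true × T u w ≡ false

  -- Havet and Thomassé's argument: the vertices outside p ∪ q cut the order into
  -- intervals, and on each interval the vertex that closes it sees all of p.
  feed-bound : ∀ {p q : A → Bool} → (∀ w → p w ≡ false → q w ≡ false → Dominates p w) →
    ∀ {f ys} → p f ≡ false → q f ≡ false → Median (f ∷ ys) → tally p (f ∷ ys) ≤ tally q (f ∷ ys)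
  feed-bound {p} {q} dominates {f} {ys} ¬pf ¬qf (st ∷ med) rewrite ¬pf | ¬qf =
    block f [] ys (dominates f ¬pf ¬qf) st [] med
    where
    -- All of `p` in `zs` consists of out-neighbours of `x`, while its in-neighbours there avoid `p`
    -- and so lie in `q`; stability compares the two.
    close : ∀ {x zs} → Dominates p x → tally (T x) zs ≤ tally (λ z → T z x) zs →
      All (λ u → p u ≡ false → q u ≡ true) zs → tally p zs ≤ tally q zs
    close {x} {zs} dom st good = ≤-trans
      (tally-mono {xs = zs} (All.tabulate (λ {u} _ pu → proj₁ (dom u pu))))
      (≤-trans st (tally-mono (All.map (λ {u} g Tux → g (outside u Tux)) good)))
      where
      outside : ∀ u → T u x ≡ true → p u ≡ false
      outside u Tux with p u in pu
      ... | false = refl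
      ... | true  = trans (sym Tux) (proj₂ (dom u pu))
    block : ∀ x zs ws → Dominates p x → Stable x (zs ++ ws) →
      All (λ u → p u ≡ false → q u ≡ true) zs → Median ws → tally p (zs ++ ws) ≤ tally q (zs ++ ws)
    continue : ∀ x zs w ws → Dominates p x → Stable x (zs ++ w ∷ ws) →
      All (λ u → p u ≡ false → q u ≡ true) zs → (p w ≡ false → q w ≡ true) → Median ws →
      tally p (zs ++ w ∷ ws) ≤ tally q (zs ++ w ∷ ws)
    block x zs [] dom st good med rewrite tally-++ p zs [] | tally-++ q zs [] =
      +-mono-≤ (close dom (st zs [] refl) good) z≤n
    block x zs (w ∷ ws) dom st good (stw ∷ med) with p w in pw | q w in qw
    ... | false | false = subst₂ _≤_ (sym (tally-++ p zs (w ∷ ws))) (sym (tally-++ q zs (w ∷ ws)))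
      (+-mono-≤ (close dom (st zs (w ∷ ws) refl) good)
        (+-mono-≤ (𝟙-mono (λ pw′ → case trans (sym pw) pw′ of λ ())) (block w [] ws (dominates w pw qw) stw [] med)))
    ... | true  | _     = continue x zs w ws dom st good (λ ¬pw → case trans (sym pw) ¬pw of λ ()) med
    ... | false | true  = continue x zs w ws dom st good (λ _ → qw) med
    continue x zs w ws dom st good good′ med = subst (λ l → tally p l ≤ tally q l) reassociate
      (block x (zs ++ [ w ]) ws dom (subst (Stable x) (sym reassociate) st) (∷ʳ⁺ good good′) med)
      where
      reassociate : (zs ++ [ w ]) ++ ws ≡ zs ++ w ∷ ws
      reassociate = ++-assoc zs [ w ] ws

-- Induced subgraphs of the missing graph

-- The isomorphism covers only vertices that meet a missing edge. Those of a copy of `H` do, as `H`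
-- has no isolated vertex, so the copy pulls back to `G`.
neighbours-in-missing : ∀ {k m n} {H : Graph k} {D : Digraph m} {G : Graph n} → MissingGraph D G →
  (∀ i → ∃ λ j → H i j ≡ true) → ¬ InducedSub H G → ¬ InducedSub H (missingᵇ D)
neighbours-in-missing {H = H} {D} {G} (f , f-inj , f-edges , f-onto) neighbour H⊄G (g , g-inj , g-edges) =
  H⊄G (g′ , (λ eq → g-inj (trans (sym (fg′ _)) (trans (cong f eq) (fg′ _)))) , edges)
  where
  preimage : ∀ i → ∃ λ k → f k ≡ g i
  preimage i with neighbour i
  ... | j , Hij = f-onto (g i) (g j) (trans (sym (g-edges i j)) Hij)
  g′ : Fin _ → Fin _
  g′ = proj₁ ∘ preimage
  fg′ : ∀ i → f (g′ i) ≡ g i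
  fg′ = proj₂ ∘ preimage
  edges : ∀ i j → H i j ≡ G (g′ i) (g′ j)
  edges i j = trans (g-edges i j) (trans (cong₂ (missingᵇ D) (sym (fg′ i)) (sym (fg′ j))) (sym (f-edges (g′ i) (g′ j))))

module SecondNeighbourhood {m : ℕ} (d : Digraph m) (oriented : IsOriented d)
  (C₄-free : ¬ InducedSub C4 (missingᵇ d)) (2K₂-free : ¬ InducedSub (complement C4) (missingᵇ d))
  (S₃-free : ¬ InducedSub S3 (missingᵇ d)) (chair-free : ¬ InducedSub chair (missingᵇ d))
  (co-chair-free : ¬ InducedSub (complement chair) (missingᵇ d)) where

  open IsOriented oriented

  private
    V : Set
    V = Fin m

    variable
      a b c e p q r s t u v w x y z u′ v′ w′ z′ a′ b′ : V

  infix 4 _⇒_ _~_ _≁_ _⇒?_ _~?_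

  _⇒_ _≁_ : V → V → Set

  -- A record rather than a synonym, so that the vertices can be inferred from a proof.
  record _~_ (u v : V) : Set where
    constructor edge
    field missing-edge : missingᵇ d u v ≡ true
  open _~_

  u ⇒ v = d u v ≡ true
  u ≁ v = ¬ u ~ v

  _⇒?_ : ∀ u v → Dec (u ⇒ v)
  u ⇒? v = d u v Bool.≟ true

  _~?_ : ∀ u v → Dec (u ~ v)
  u ~? v = map′ edge missing-edge (missingᵇ d u v Bool.≟ true)

  data Position (u v : V) : Set where
    equal   : u ≡ v → Position u v
    forward : u ⇒ v → Position u v
    back    : v ⇒ u → Position u v
    missing : u ~ v → Position u v

  position : ∀ u v → Position u v
  position u v with u ≟ v in eq | d u v in uv | d v u in vu
  ... | yes u≡v | _     | _     = equal u≡v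
  ... | no  _   | true  | _     = forward uv
  ... | no  _   | false | true  = back vu
  ... | no  _   | false | false = missing (edge (cong₂ _∧_ (cong (not ∘ ⌊_⌋) eq) (cong₂ _∧_ (cong not uv) (cong not vu))))

  ~⇒≢ : u ~ v → u ≢ v
  ~⇒≢ {u} uv refl with u ≟ u | missing-edge uv
  ... | no u≢u | _  = u≢u refl
  ... | yes _  | ()

  missing-irrefl : ∀ u → missingᵇ d u u ≡ false
  missing-irrefl u = ¬-not (λ uu → ~⇒≢ (edge {u} {u} uu) refl)

  ~⇒⇏ : u ~ v → ¬ u ⇒ v
  ~⇒⇏ {u} {v} uv uv′ with ∧-true {not (eqᵇ u v)} (missing-edge uv)
  ... | _ , h = contradiction (cong not uv′) (not-¬ (proj₁ (∧-true {not (d u v)} h)))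

  ~-sym : u ~ v → v ~ u
  ~-sym {u} {v} uv with position v u
  ... | missing vu = vu
  ... | equal refl = uv
  ... | back uv′   = contradiction uv′ (~⇒⇏ uv)
  ... | forward vu with ∧-true {not (eqᵇ u v)} (missing-edge uv)
  ...   | _ , h    = contradiction (cong not vu) (not-¬ (proj₂ (∧-true {not (d u v)} h)))

  ⇒⇒≁ : u ⇒ v → u ≁ v
  ⇒⇒≁ = flip ~⇒⇏

  ⇐⇒≁ : v ⇒ u → u ≁ v
  ⇐⇒≁ vu uv = ~⇒⇏ (~-sym uv) vu

  ≁-sym : u ≁ v → v ≁ u
  ≁-sym = _∘ ~-sym

  ⇒-asym : u ⇒ v → ¬ v ⇒ u
  ⇒-asym uv vu = case trans (sym vu) (no2cycle _ _ uv) of λ ()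

  ⇒-irrefl : ¬ u ⇒ u
  ⇒-irrefl uu = ⇒-asym uu uu

  ⇒⇒≢ : u ⇒ v → u ≢ v
  ⇒⇒≢ uv refl = ⇒-irrefl uv

  separated : u ~ w → v ≁ w → u ≢ v
  separated uw vw refl = vw uw

  -- Forbidden subgraphs as adjacency patterns

  Adjacency : Bool → V → V → Set
  Adjacency true  u v = u ~ v
  Adjacency false u v = u ≁ v × u ≢ v

  Adjacencies : ∀ {k} → (Fin k → Bool) → V → Vec V k → Set
  Adjacencies h x []       = ⊤
  Adjacencies h x (y ∷ ys) = Adjacency (h zero) x y × Adjacencies (h ∘ suc) x ys

  Realises : ∀ {k} → Graph k → Vec V k → Set
  Realises h []       = ⊤
  Realises h (x ∷ xs) = Adjacencies (h zero ∘ suc) x xs × Realises (λ i j → h (suc i) (suc j)) xs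

  induced : ∀ {k} {h : Graph k} → (∀ i → h i i ≡ false) → (∀ i j → h i j ≡ h j i) →
    (xs : Vec V k) → Realises h xs → InducedSub h (missingᵇ d)
  induced {h = h} h-irrefl h-sym xs real = lookup xs , injective , edges
    where
    at : ∀ {k} {h : Fin k → Bool} {x} {ys} → Adjacencies h x ys → ∀ j → Adjacency (h j) x (lookup ys j)
    at {ys = _ ∷ _} (adj , _)    zero    = adj
    at {ys = _ ∷ _} (_   , adjs) (suc j) = at adjs j
    adjacency : ∀ {k} {h : Graph k} → (∀ i j → h i j ≡ h j i) → (xs : Vec V k) → Realises h xs →
      ∀ i j → i ≢ j → Adjacency (h i j) (lookup xs i) (lookup xs j)
    adjacency h-sym (x ∷ xs) real zero zero 0≢0 = contradiction refl 0≢0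
    adjacency h-sym (x ∷ xs) (row , real) zero (suc j) _ = at row j
    adjacency {h = h} h-sym (x ∷ xs) (row , real) (suc i) zero _ rewrite h-sym (suc i) zero =
      flipped (h zero (suc i)) (at row i)
      where
      flipped : ∀ b {u v} → Adjacency b u v → Adjacency b v u
      flipped true  uv          = ~-sym uv
      flipped false (uv , u≢v) = ≁-sym uv , u≢v ∘ sym
    adjacency h-sym (x ∷ xs) (row , real) (suc i) (suc j) i≢j =
      adjacency (λ i j → h-sym (suc i) (suc j)) xs real i j (i≢j ∘ cong suc)
    distinct : ∀ b → Adjacency b u v → u ≢ v
    distinct true  = ~⇒≢
    distinct false = proj₂
    injective : Injective _≡_ _≡_ (lookup xs)
    injective {i} {j} eq with i ≟ j
    ... | yes i≡j = i≡j
    ... | no  i≢j = contradiction eq (distinct (h i j) (adjacency h-sym xs real i j i≢j))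
    value : ∀ b → Adjacency b u v → b ≡ missingᵇ d u v
    value true  uv       = sym (missing-edge uv)
    value false (uv , _) = sym (¬-not (uv ∘ edge))
    edges : ∀ i j → h i j ≡ missingᵇ d (lookup xs i) (lookup xs j)
    edges i j with i ≟ j
    ... | yes refl = trans (h-irrefl i) (sym (missing-irrefl (lookup xs i)))
    ... | no  i≢j  = value (h i j) (adjacency h-sym xs real i j i≢j)

  -- Opposite vertices have the same neighbours in the cycle, so `separated` cannot tell them apart
  -- and their distinctness is assumed; likewise for the leaves `t` and `v` of the chair.
  no-C₄ : a ~ b → b ~ c → c ~ e → e ~ a → a ≁ c → b ≁ e → a ≢ c → b ≢ e → ⊥
  no-C₄ ab bc ce ea ac be a≢c b≢e = C₄-free (induced
    (from-yes (all? λ i → C4 i i Bool.≟ false)) (from-yes (all? λ i → all? λ j → C4 i j Bool.≟ C4 j i))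
    (_ ∷ _ ∷ _ ∷ _ ∷ [])
    ((ab , (ac , a≢c) , ~-sym ea , tt) , (bc , (be , b≢e) , tt) , (ce , tt) , tt , tt))

  no-2K₂ : a ~ b → c ~ e → a ≁ c → a ≁ e → b ≁ c → b ≁ e → ⊥
  no-2K₂ ab ce ac ae bc be = 2K₂-free (induced
    (from-yes (all? λ i → complement C4 i i Bool.≟ false))
    (from-yes (all? λ i → all? λ j → complement C4 i j Bool.≟ complement C4 j i))
    (_ ∷ _ ∷ _ ∷ _ ∷ [])
    (((ac , separated ab (≁-sym bc)) , ab , (ae , separated ab (≁-sym be)) , tt) ,
     ((≁-sym bc , separated ce be) , ce , tt) , ((be , separated (~-sym ab) (≁-sym ae)) , tt) , tt , tt))

  no-chair : x ~ y → y ~ z → z ~ t → z ~ v → x ≁ z → x ≁ t → x ≁ v → y ≁ t → y ≁ v → t ≁ v → t ≢ v → ⊥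
  no-chair xy yz zt zv xz xt xv yt yv tv t≢v = chair-free (induced
    (from-yes (all? λ i → chair i i Bool.≟ false)) (from-yes (all? λ i → all? λ j → chair i j Bool.≟ chair j i))
    (_ ∷ _ ∷ _ ∷ _ ∷ _ ∷ [])
    ((xy , (xz , ≢-sym (separated zt xt)) , (xt , separated xy (≁-sym yt)) , (xv , separated xy (≁-sym yv)) , tt) ,
     (yz , (yt , separated (~-sym xy) (≁-sym xt)) , (yv , separated (~-sym xy) (≁-sym xv)) , tt) ,
     (zt , zv , tt) , ((tv , t≢v) , tt) , tt , tt))

  no-co-chair : x ~ z → x ~ t → x ~ v → y ~ t → y ~ v → t ~ v → x ≁ y → y ≁ z → z ≁ t → z ≁ v → ⊥
  no-co-chair xz xt xv yt yv tv xy yz zt zv = co-chair-free (induced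
    (from-yes (all? λ i → complement chair i i Bool.≟ false))
    (from-yes (all? λ i → all? λ j → complement chair i j Bool.≟ complement chair j i))
    (_ ∷ _ ∷ _ ∷ _ ∷ _ ∷ [])
    (((xy , separated xz yz) , xz , xt , xv , tt) ,
     ((yz , separated yt zt) , yt , yv , tt) ,
     ((zt , ≢-sym (separated tv zv)) , (zv , ≢-sym (separated (~-sym tv) zt)) , tt) , (tv , tt) , tt , tt))

  no-S₃ : a ~ b → b ~ c → a ~ c → p ~ a → p ~ b → p ≁ c → q ~ b → q ~ c → q ≁ a → r ~ a → r ~ c → r ≁ b →
    p ≁ q → q ≁ r → p ≁ r → ⊥
  no-S₃ ab bc ac pa pb pc qb qc qa ra rc rb pq qr pr = S₃-free (induced
    (from-yes (all? λ i → S3 i i Bool.≟ false)) (from-yes (all? λ i → all? λ j → S3 i j Bool.≟ S3 j i))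
    (_ ∷ _ ∷ _ ∷ _ ∷ _ ∷ _ ∷ [])
    ((ab , ac , ~-sym pa , (≁-sym qa , separated (~-sym pa) (≁-sym pq)) , ~-sym ra , tt) ,
     (bc , ~-sym pb , ~-sym qb , (≁-sym rb , separated (~-sym pb) (≁-sym pr)) , tt) ,
     ((≁-sym pc , separated (~-sym qc) pq) , ~-sym qc , ~-sym rc , tt) ,
     ((pq , separated pa qa) , (pr , separated pb rb) , tt) , ((qr , separated qb rb) , tt) , tt , tt))

  -- Induced paths on four vertices

  record P₄ (a b c e : V) : Set where
    constructor path
    field
      ab : a ~ b
      bc : b ~ c
      ce : c ~ e
      ac : a ≁ c
      ae : a ≁ e
      be : b ≁ e

  open P₄

  reverse : P₄ a b c e → P₄ e c b a
  reverse (path ab bc ce ac ae be) = path (~-sym ce) (~-sym bc) (~-sym ab) (≁-sym be) (≁-sym ae) (≁-sym ac)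

  -- If `x ≁ e`, then `xa` and `ce` form a 2K₂ unless `x ~ c`, and in that case there is a co-chair
  -- or a C₄ according to whether `x ~ b`.
  ends-twins : P₄ a b c e → x ~ a → x ≢ b → x ~ e
  ends-twins {a} {b} {c} {e} {x} (path ab bc ce ac ae be) xa x≢b = decidable-stable (x ~? e) λ xe →
    case x ~? c of λ where
      (no  xc) → no-2K₂ xa ce xc xe ac ae
      (yes xc) → case x ~? b of λ where
        (yes xb) → no-co-chair ce (~-sym xc) (~-sym bc) (~-sym xa) ab xb (≁-sym ac) ae (≁-sym xe) (≁-sym be)
        (no  xb) → no-C₄ xa ab bc (~-sym xc) xb ac x≢b (≢-sym (separated ce ae))

  -- If `x ≁ c`, then `x ~ e` closes a C₄; otherwise `x ~ a` gives a 2K₂, and `x ≁ a` makes `x` and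
  -- `a` the leaves of a chair.
  middles-twins : P₄ a b c e → x ~ b → x ≢ a → x ≢ c → x ~ c
  middles-twins {a} {b} {c} {e} {x} (path ab bc ce ac ae be) xb x≢a x≢c = decidable-stable (x ~? c) λ xc →
    case x ~? e of λ where
      (yes xe) → no-C₄ xb bc ce (~-sym xe) xc be x≢c (separated (~-sym ab) (≁-sym ae))
      (no  xe) → case x ~? a of λ where
        (yes xa) → no-2K₂ xa ce xc xe ac ae
        (no  xa) → no-chair (~-sym ce) (~-sym bc) (~-sym ab) (~-sym xb) (≁-sym be) (≁-sym ae) (≁-sym xe)
                     (≁-sym ac) (≁-sym xc) (≁-sym xa) (≢-sym x≢a)

  ends-twins′ : P₄ a b c e → x ~ e → x ≢ c → x ~ a
  ends-twins′ P = ends-twins (reverse P)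

  middles-twins′ : P₄ a b c e → x ~ c → x ≢ b → x ≢ e → x ~ b
  middles-twins′ P xc x≢b x≢e = middles-twins (reverse P) xc x≢e x≢b

  -- The losing relation between missing edges

  Unreachable : V → V → Set
  Unreachable w v = ¬ w ⇒ v × (∀ y → w ⇒ y → ¬ y ⇒ v)

  infix 4 _≻_
  _≻_ : V × V → V × V → Set
  (a , b) ≻ (u , v) = (a ~ b × u ~ v) × (a ⇒ u × b ⇒ v) × Unreachable a v × Unreachable b u

  ≻-swap : (a , b) ≻ (u , v) → (b , a) ≻ (v , u)
  ≻-swap ((ab , uv) , (au , bv) , av , bu) = (~-sym ab , ~-sym uv) , (bv , au) , bu , av

  -- Across the two edges only `bu` and `av` can be missing; both together give a C₄, neither gives
  -- a 2K₂.
  ≻⇒P₄ : (a , b) ≻ (u , v) → P₄ a b u v ⊎ P₄ b a v u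
  ≻⇒P₄ {a} {b} {u} {v} ((ab , uv) , (au , bv) , _) with b ~? u | a ~? v
  ... | yes bu | yes av = ⊥-elim (no-C₄ ab bu uv (~-sym av) (⇒⇒≁ au) (⇒⇒≁ bv) (⇒⇒≢ au) (⇒⇒≢ bv))
  ... | yes bu | no  av = inj₁ (path ab bu uv (⇒⇒≁ au) av (⇒⇒≁ bv))
  ... | no  bu | yes av = inj₂ (path (~-sym ab) av (~-sym uv) (⇒⇒≁ bv) bu (⇒⇒≁ au))
  ... | no  bu | no  av = ⊥-elim (no-2K₂ ab uv (⇒⇒≁ au) av bu (⇒⇒≁ bv))

  -- In the main case, `u ≢ u′` on paths of the same direction, unreachability leaves only a missing
  -- edge between `u′` and `v`. The twin ends carry it to `u′` and `a`, against `a ⇒ u′`.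
  ≻-functional : (a , b) ≻ (u , v) → (a , b) ≻ (u′ , v′) → u ≡ u′ × v ≡ v′
  ≻-functional = λ h h′ → case ≻⇒P₄ h of λ where
      (inj₁ P) → along P h h′
      (inj₂ P) → let v≡v′ , u≡u′ = along P (≻-swap h) (≻-swap h′) in u≡u′ , v≡v′
    where
    along : P₄ a b u v → (a , b) ≻ (u , v) → (a , b) ≻ (u′ , v′) → u ≡ u′ × v ≡ v′
    along {a} {b} {u} {v} {u′} {v′} P (_ , (au , bv) , av , bu) h′@((_ , u′v′) , (au′ , bv′) , av′ , bu′)
      with ≻⇒P₄ h′
    ... | inj₂ P′ = contradiction (ends-twins P (~-sym (bc P′)) (≢-sym (⇒⇒≢ bv′)))
      λ v′v → ⇒⇒≁ au′ (~-sym (middles-twins′ (path (ab P′) (bc P′) v′v (ac P′) (be P) (ae P)) u′v′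
          (≢-sym (⇒⇒≢ au′)) λ { refl → proj₁ av au′ }))
    ... | inj₁ P′ with u ≟ u′
    ...   | yes refl = refl , decidable-stable (v ≟ v′) λ v≢v′ →
            ⇒⇒≁ bv′ (~-sym (middles-twins′ P (~-sym u′v′) (≢-sym (⇒⇒≢ bv′)) (≢-sym v≢v′)))
    ...   | no u≢u′ with position u′ v
    ...     | equal refl   = contradiction au′ (proj₁ av)
    ...     | forward u′v  = contradiction u′v (proj₂ av u′ au′)
    ...     | back vu′     = contradiction vu′ (proj₂ bu′ v bv)
    ...     | missing u′v  = contradiction (~-sym (ends-twins′ P u′v (≢-sym u≢u′))) (⇒⇒≁ au′)

  ≻-injective : (a , b) ≻ (u , v) → (a′ , b′) ≻ (u , v) → a ≡ a′ × b ≡ b′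
  ≻-injective = λ h h′ → case ≻⇒P₄ h of λ where
      (inj₁ P) → along P h h′
      (inj₂ P) → let b≡b′ , a≡a′ = along P (≻-swap h) (≻-swap h′) in a≡a′ , b≡b′
    where
    along : P₄ a b u v → (a , b) ≻ (u , v) → (a′ , b′) ≻ (u , v) → a ≡ a′ × b ≡ b′
    along {a} {b} {u} {v} {a′} {b′} P (_ , (au , bv) , av , bu) h′@(_ , (a′u , b′v) , a′v , b′u) with ≻⇒P₄ h′
    ... | inj₂ P′ = contradiction (ends-twins P (middles-twins′ Q (ab P′) (λ { refl → proj₁ b′u au }) (⇒⇒≢ b′v))
                      (≢-sym (separated (bc P) (ae P′)))) (⇒⇒≁ b′v)
      where
      Q : P₄ b a a′ v
      Q = path (~-sym (ab P)) (~-sym (ends-twins′ P (bc P′) (⇒⇒≢ a′u))) (bc P′)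
        (λ ba′ → ⇒⇒≁ a′u (middles-twins P (~-sym ba′) (~⇒≢ (ends-twins′ P (bc P′) (⇒⇒≢ a′u))) (⇒⇒≢ a′u))) (be P) (ae P)
    ... | inj₁ P′ with b ≟ b′
    ...   | yes refl = decidable-stable (a ≟ a′) (λ a≢a′ →
            ⇒⇒≁ a′u (middles-twins P (ab P′) (≢-sym a≢a′) (⇒⇒≢ a′u))) , refl
    ...   | no b≢b′ with position a b′
    ...     | equal refl  = contradiction au (~⇒⇏ (bc P′))
    ...     | forward ab′ = contradiction b′v (proj₂ av b′ ab′)
    ...     | back b′a    = contradiction au (proj₂ b′u a b′a)
    ...     | missing ab′ = contradiction (ends-twins P (~-sym ab′) (≢-sym b≢b′)) (⇒⇒≁ b′v)

  -- The violators of u v are the vertices for which orienting the missing edge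
  -- from u to v would create a new second out-neighbour v.
  Violates : V → V → V → Set
  Violates u v w = w ⇒ u × Unreachable w v

  Justified : V → V → Set
  Justified u v = ∀ w → Violates u v w → ∃ λ z → (w , z) ≻ (u , v)

  Active : V → V → Set
  Active a b = ∃₂ λ u v → (a , b) ≻ (u , v)

  -- Breaks the tie between the two orientations of a missing edge without violators.
  Prefers : V → V → Set
  Prefers x b = ∃ λ a → (Active a b × Justified a b) × Unreachable a x × a ≢ x

  -- An arc between the violators would continue to `v` or to `u`, so `wz` is missing. With
  -- `loser-violates`, some edge loses to `uv` exactly if both orientations of `uv` have violators.
  violators-lose : u ~ v → Violates u v w → Violates v u z → (w , z) ≻ (u , v)
  violators-lose {w = w} {z} uv (wu , wv) (zv , zu) with position w z
  ... | equal refl = contradiction zv (proj₁ wv)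
  ... | forward wz = contradiction zv (proj₂ wv z wz)
  ... | back zw    = contradiction wu (proj₂ zu w zw)
  ... | missing wz = (wz , uv) , (wu , zv) , wv , zu

  loser-violates : (w , z) ≻ (u , v) → Violates u v w × Violates v u z
  loser-violates (_ , (wu , zv) , wv , zu) = (wu , wv) , (zv , zu)

  -- A violator `w` satisfies `w ~ a`: an arc `a ⇒ w` would reach `x`, and `w ⇒ a` would make `w`
  -- violate `a b`, so that an edge at `w` loses to `ab` and its twins give `w ~ x`. The path
  -- through `ab` then yields a C₄, a 3-sun or `x ~ w`, against `w ⇒ x`.
  no-violator : (a , b) ≻ (u , v) → Justified a b → Unreachable a x → x ≢ a → x ~ b →
    P₄ a b u v ⊎ P₄ b a v u × x ~ a → ¬ Violates x b w
  no-violator {a} {b} {u} {v} {x} {w} (_ , (au , bv) , _) just ax x≢a xb type (wx , wb) =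
    [ first , (λ (P , xa) → second P xa) ]′ type
    where
    wa : w ~ a
    wa with position w a
    ... | equal refl = contradiction wx (proj₁ ax)
    ... | back aw    = contradiction wx (proj₂ ax w aw)
    ... | missing wa = wa
    ... | forward wa with ≻⇒P₄ (proj₂ (just w (wa , wb)))
    ...   | inj₁ P = contradiction (ends-twins′ P xb x≢a) (⇐⇒≁ wx)
    ...   | inj₂ P = contradiction (middles-twins′ P xb (≢-sym (⇒⇒≢ wx)) x≢a) (⇐⇒≁ wx)
    w≢b : w ≢ b
    w≢b refl = ⇒⇒≁ wx (~-sym xb)
    x≢w : x ≢ w
    x≢w = ≢-sym (⇒⇒≢ wx)
    first : P₄ a b u v → ⊥
    first P = case w ~? b of λ where
        (yes wb) → case x ~? a of λ where
          (yes xa) → no-C₄ (~-sym xa) (ends-twins P xa (~⇒≢ xb)) (~-sym wv) wa (ae P) (⇐⇒≁ wx)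
                       (separated (ab P) (≁-sym (be P))) x≢w
          (no  xa) → no-S₃ (bc P) (~-sym (middles-twins P wb (~⇒≢ wa) w≢u)) (~-sym wb)
                       xb (middles-twins P xb x≢a x≢u) (⇐⇒≁ wx)
                       (~-sym (ce P)) (~-sym wv) (≁-sym (be P)) (ab P) (~-sym wa) (ac P)
                       (λ xv → xa (ends-twins′ P xv x≢u)) (≁-sym (ae P)) xa
        (no wb) → let
            wu = λ w~u → wb (middles-twins′ P w~u w≢b (~⇒≢ wv))
            xa = middles-twins′ (path wa (ab P) (bc P) wb wu (ac P)) xb x≢a x≢u
          in ⇐⇒≁ wx (middles-twins (path (~-sym (ab P)) (~-sym wa) wv (≁-sym wb) (be P) (ae P)) xa (~⇒≢ xb) x≢w)
      where
      x≢u : x ≢ u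
      x≢u refl = proj₁ ax au
      w≢u : w ≢ u
      w≢u refl = ⇒⇒≁ au (~-sym wa)
      wv : w ~ v
      wv = ends-twins P wa w≢b
    second : P₄ b a v u → x ~ a → ⊥
    second P xa = case w ~? b of λ where
        (yes wb) → no-C₄ (~-sym xb) xu (~-sym (ends-twins P wb (~⇒≢ wa))) wb (ae P) (⇐⇒≁ wx)
                     (separated (ab P) (≁-sym (be P))) x≢w
        (no  wb) → no-S₃ (~-sym xa) xv (bc P) (ab P) (~-sym xb) (ac P) (~-sym xu) (~-sym (ce P)) (≁-sym (be P))
                     wa wv (⇒⇒≁ wx) (ae P) (λ uw → wb (ends-twins′ P (~-sym uw) w≢v)) (≁-sym wb)
      where
      xu : x ~ u
      xu = ends-twins P xb x≢a
      xv : x ~ v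
      xv = middles-twins P xa (~⇒≢ xb) (separated xb (≁-sym (ac P)))
      w≢v : w ≢ v
      w≢v refl = ⇐⇒≁ wx xv
      wv : w ~ v
      wv = middles-twins P wa w≢b w≢v

  -- End edges of induced paths and the consistency of preferences

  EndEdge : V → V → Set
  EndEdge a b = ∃₂ λ c e → P₄ a b c e ⊎ P₄ b a c e

  EndEdge-sym : EndEdge a b → EndEdge b a
  EndEdge-sym (c , e , inj₁ P) = c , e , inj₂ P
  EndEdge-sym (c , e , inj₂ P) = c , e , inj₁ P

  Active⇒EndEdge : Active a b → EndEdge a b
  Active⇒EndEdge (u , v , h) = case ≻⇒P₄ h of λ where
    (inj₁ P) → u , v , inj₁ P
    (inj₂ P) → v , u , inj₂ P

  -- The twin properties copy the adjacencies of `x` and of a counterexample `y` to the far part of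
  -- the path, which produces a C₄ or a 3-sun.
  triangle-dominates : EndEdge a b → x ~ a → x ~ b → y ~ a → y ≢ x → y ~ x
  triangle-dominates {a} {b} {x} {y} (c , e , type) xa xb ya y≢x = decidable-stable (y ~? x) λ yx →
    let y≢b = ≢-sym (separated (~-sym xb) yx) in
    case type of λ where
      (inj₁ P) → no-C₄ (~-sym xa) (ends-twins P xa (~⇒≢ xb)) (~-sym (ends-twins P ya y≢b)) ya
                   (ae P) (≁-sym yx) (separated (ab P) (≁-sym (be P))) (≢-sym y≢x)
      (inj₂ P) → let
          xe = ends-twins P xb (~⇒≢ xa)
          xc = middles-twins P xa (~⇒≢ xb) (separated xb (≁-sym (ac P)))
          y≢c = ≢-sym (separated (~-sym xc) yx)
          yc = middles-twins P ya y≢b y≢c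
        in case y ~? b of λ where
          (yes yb) → no-C₄ (~-sym xb) xe (~-sym (ends-twins P yb (~⇒≢ ya))) yb
                       (ae P) (≁-sym yx) (separated (ab P) (≁-sym (be P))) (≢-sym y≢x)
          (no  yb) → no-S₃ (~-sym xa) xc (bc P) (ab P) (~-sym xb) (ac P) (~-sym xe) (~-sym (ce P)) (≁-sym (be P))
                       ya yc yx (ae P) (λ ey → yb (ends-twins′ P (~-sym ey) y≢c)) (≁-sym yb)

  end-edges-in-triangle : EndEdge a b → EndEdge a x → a ~ b → b ~ x → ⊥
  end-edges-in-triangle ab-end (r , t , inj₁ P) ab bx = be P (~-sym (triangle-dominates (EndEdge-sym ab-end)
    (~-sym bx) (~-sym (P₄.ab P)) (~-sym (ends-twins P (~-sym ab) (~⇒≢ bx)))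
    (≢-sym (separated (~-sym (P₄.ab P)) (≁-sym (ae P))))))
  end-edges-in-triangle ab-end (r , t , inj₂ P) ab bx = ac P (~-sym (triangle-dominates ab-end
    (P₄.ab P) (~-sym bx) (~-sym (bc P)) (separated (ce P) (ae P))))

  end-edges-in-square : EndEdge a b → EndEdge x y → a ~ b → b ~ x → x ~ y → y ~ a → a ~ x → ⊥
  end-edges-in-square ab-end xy-end@(r , t , type) ab bx xy ya ax = case type of λ where
    (inj₁ P) → let
        ra = triangle-dominates (EndEdge-sym xy-end) (~-sym ya) ax (~-sym (bc P)) (λ { refl → ac P (~-sym ax) })
      in ac P (~-sym (triangle-dominates ab-end (~-sym ax) (~-sym bx) ra (separated (ce P) (ae P))))
    (inj₂ P) → be P (~-sym (triangle-dominates ab-end (~-sym ax) (~-sym bx)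
        (~-sym (ends-twins P (~-sym ya) (~⇒≢ ax))) (≢-sym (separated xy (≁-sym (ae P))))))

  private
    -- An arc `a ⇒ y` makes `a` violate `y x`, so some edge `az` loses to `yx`; every placement of
    -- `z` then conflicts with `bx` and the path through `ab`.
    preferences-along-arc : (a , b) ≻ (u , v) → Unreachable a x → a ≢ x → Justified y x → Unreachable y b → y ≢ b →
      b ~ x → ¬ a ⇒ y
    preferences-along-arc {a} {b} {u} {v} {x} {y} h@((ab , uv) , (au , bv) , av , bu) ax a≢x just yb y≢b bx ay
      with just a (ay , ax)
    ... | z , k with ≻⇒P₄ k
    ...   | inj₂ P = ac P (triangle-dominates (Active⇒EndEdge (u , v , h)) (~-sym (bc P)) (~-sym bx)
                       (P₄.ab P) (≢-sym (separated (ce P) (ae P))))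
    ...   | inj₁ P with z ≟ b
    ...     | yes refl = be P bx
    ...     | no z≢b = case ≻⇒P₄ h of λ where
        (inj₁ Q) → ac Q (~-sym (middles-twins′ zabx (~-sym (bc Q)) (≢-sym (⇒⇒≢ au)) (λ { refl → proj₁ ax au })))
        (inj₂ Q) → case v ≟ z of λ where
          (no  v≢z)  → ac Q (~-sym (middles-twins zabx (~-sym (bc Q)) v≢z (λ { refl → ae Q (ce Q) })))
          (yes refl) → be Q (~-sym (middles-twins′ (path (~-sym ab) (P₄.ab P) (bc P) bz b≁y (ac P)) uv
                         (≢-sym (⇒⇒≢ au)) (λ { refl → proj₁ bu b⇒y })))
      where
      b≢x : b ≢ x
      b≢x = ~⇒≢ bx
      bz : b ≁ z
      bz b~z = be P (~-sym (triangle-dominates (EndEdge-sym (Active⇒EndEdge (u , v , h))) (~-sym b~z) (~-sym (P₄.ab P))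
                 (~-sym bx) (≢-sym (separated (~-sym (P₄.ab P)) (≁-sym (ae P))))))
      b≁y : b ≁ y
      b≁y b~y = bz (middles-twins′ P b~y (≢-sym z≢b) b≢x)
      b⇒y : b ⇒ y
      b⇒y with position b y
      ... | equal refl   = contradiction refl y≢b
      ... | forward b⇒y  = b⇒y
      ... | back y⇒b     = contradiction y⇒b (proj₁ yb)
      ... | missing b~y  = contradiction b~y b≁y
      zabx : P₄ z a b x
      zabx = path (~-sym (P₄.ab P)) ab bx (≁-sym bz) (be P) (ae P)

  -- Equal witnesses `a` and `y` put two end edges in a triangle, and an arc is excluded by
  -- `preferences-along-arc`. A missing edge closes the square `a b x y`: a diagonal contradicts
  -- `end-edges-in-square`, and without one it is a C₄.
  preferences-exclude : b ~ x → Prefers x b → ¬ Prefers b x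
  preferences-exclude {b} {x} bx (a , ((u , v , h@((ab , _) , _)) , just) , ax , a≢x)
                                 (y , ((u′ , v′ , h′@((yx , _) , _)) , just′) , yb , y≢b) =
    case position a y of λ where
      (equal refl)  → end-edges-in-triangle ab-end yx-end ab bx
      (forward a⇒y) → preferences-along-arc h ax a≢x just′ yb y≢b bx a⇒y
      (back y⇒a)    → preferences-along-arc h′ yb y≢b just ax a≢x (~-sym bx) y⇒a
      (missing ay)  → case a ~? x of λ where
        (yes a~x) → end-edges-in-square ab-end (EndEdge-sym yx-end) ab bx (~-sym yx) (~-sym ay) a~x
        (no a≁x)  → case b ~? y of λ where
          (yes b~y) → end-edges-in-square yx-end (EndEdge-sym ab-end) yx (~-sym bx) (~-sym ab) ay (~-sym b~y)
          (no b≁y)  → no-C₄ ab bx (~-sym yx) (~-sym ay) a≁x b≁y a≢x (≢-sym y≢b)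
    where
    ab-end : EndEdge a b
    ab-end = Active⇒EndEdge (u , v , h)
    yx-end : EndEdge y x
    yx-end = Active⇒EndEdge (u′ , v′ , h′)

  -- Chains of losing edges

  Chain : ℕ → V → V → Set
  Chain zero    u v = ⊤
  Chain (suc n) u v = ∃₂ λ w z → (w , z) ≻ (u , v) × Chain n w z

  Chain-swap : ∀ n → Chain n u v → Chain n v u
  Chain-swap zero    _               = tt
  Chain-swap (suc n) (w , z , h , c) = z , w , ≻-swap h , Chain-swap n c

  Chain-take : ∀ n {k} → Chain (n + k) u v → Chain n u v
  Chain-take zero    _               = tt
  Chain-take (suc n) (w , z , h , c) = w , z , h , Chain-take n c

  record C₅ (p q r t y : V) : Set where
    constructor pentagon
    field
      pqrt : P₄ p q r t
      yt   : y ~ t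
      yp   : y ~ p
      yq   : y ≁ q
      yr   : y ≁ r

  C₅-rotate : C₅ p q r t y → C₅ q r t y p
  C₅-rotate (pentagon (path pq qr rt pr pt qt) yt yp yq yr) =
    pentagon (path qr rt (~-sym yt) qt (≁-sym yq) (≁-sym yr)) (~-sym yp) pq pr pt

  C₅-rotate⁴ : C₅ p q r t y → C₅ y p q r t
  C₅-rotate⁴ = C₅-rotate ∘ C₅-rotate ∘ C₅-rotate ∘ C₅-rotate

  C₅-rotate³ : C₅ p q r t y → C₅ t y p q r
  C₅-rotate³ = C₅-rotate ∘ C₅-rotate ∘ C₅-rotate

  -- The twin properties of the rotated paths leave the edge two steps back on the pentagon as the
  -- only one that can lose to `pq`.
  C₅-predecessor : C₅ p q r t y → (p , q) ≻ (r , t) → (w , z) ≻ (p , q) → w ≡ t × z ≡ y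
  C₅-predecessor {p} {q} {r} {t} {y} {w} {z} C (_ , (pr , qt) , _) h@(_ , (wp , zq) , _) with ≻⇒P₄ h
  ... | inj₁ P with z ≟ y
  ...   | no z≢y   = ⊥-elim (be P (middles-twins (C₅.pqrt (C₅-rotate⁴ C)) (bc P) z≢y (⇒⇒≢ zq)))
  ...   | yes refl = decidable-stable (w ≟ t) (λ w≢t →
          ac P (middles-twins (C₅.pqrt (C₅-rotate³ C)) (ab P) w≢t (⇒⇒≢ wp))) , refl
  C₅-predecessor {p} {q} {r} {t} {y} {w} {z} C (_ , (pr , qt) , _) h@(_ , (wp , zq) , _)
      | inj₂ P with w ≟ r
  ...   | no w≢r   = ⊥-elim (be P (middles-twins′ (C₅.pqrt (C₅-rotate⁴ C)) (bc P) (⇒⇒≢ wp) w≢r))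
  ...   | yes refl = ⊥-elim (ae P (ends-twins′ (C₅.pqrt C)
          (middles-twins (C₅.pqrt (C₅-rotate C)) (ab P) (⇒⇒≢ zq) (λ { refl → ⇒-asym qt zq })) (~⇒≢ (ab P))))

  record Cycle (p q r t y : V) : Set where
    constructor cycle
    field
      rim  : C₅ p q r t y
      lose₀ : (p , q) ≻ (r , t)
      lose₁ : (r , t) ≻ (y , p)
      lose₂ : (y , p) ≻ (q , r)
      lose₃ : (q , r) ≻ (t , y)
      lose₄ : (t , y) ≻ (p , q)

  Cycle-next : Cycle p q r t y → Cycle r t y p q
  Cycle-next (cycle C h₀ h₁ h₂ h₃ h₄) = cycle (C₅-rotate (C₅-rotate C)) h₁ h₂ h₃ h₄ h₀

  Cycle-previous : Cycle p q r t y → Cycle t y p q r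
  Cycle-previous = Cycle-next ∘ Cycle-next ∘ Cycle-next ∘ Cycle-next

  -- Going back two edges at a time, four losers and `pq` exhaust the five edges.
  C₅-chain : C₅ p q r t y → (p , q) ≻ (r , t) → Chain 4 p q → Cycle p q r t y
  C₅-chain C h₀ (_ , _ , h₄ , _ , _ , h₃ , _ , _ , h₂ , _ , _ , h₁ , _) with C₅-predecessor C h₀ h₄
  ... | refl , refl with C₅-predecessor (C₅-rotate³ C) h₄ h₃
  ...   | refl , refl with C₅-predecessor (C₅-rotate C) h₃ h₂
  ...     | refl , refl with C₅-predecessor (C₅-rotate⁴ C) h₂ h₁
  ...       | refl , refl = cycle C h₀ h₁ h₂ h₃ h₄

  P₄? : ∀ a b c e → Dec (P₄ a b c e)
  P₄? a b c e = map′ (λ (ab , bc , ce , ac , ae , be) → path ab bc ce ac ae be)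
    (λ (path ab bc ce ac ae be) → ab , bc , ce , ac , ae , be)
    ((a ~? b) ×-dec (b ~? c) ×-dec (c ~? e) ×-dec ¬? (a ~? c) ×-dec ¬? (a ~? e) ×-dec ¬? (b ~? e))

  Middle : V → Set
  Middle x = ∃ λ a → ∃ λ b → ∃ λ c → P₄ a x b c

  middle? : ∀ x → Dec (Middle x)
  middle? x = any? λ a → any? λ b → any? λ c → P₄? a x b c

  measured? : ∀ p x → Dec (p ⇒ x × ¬ Middle x)
  measured? p x = (p ⇒? x) ×-dec ¬? (middle? x)

  -- Outside a five-cycle, the measure of the end vertex increases from a losing edge to the next,
  -- which bounds the length of chains.
  measure : V → ℕ
  measure p = count (λ x → does (measured? p x))

  -- No five-cycle extends the induced paths that start with p q.
  Closed : V → V → Set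
  Closed p q = ∀ y → y ~ p → y ≢ q → y ~ q

  Closed-end : P₄ p q r t → Closed p q → ¬ Middle p
  Closed-end {p} {q} {r} {t} P closed (a , b , c , Q) with a ≟ q | b ≟ q
  ... | yes refl | _ = ac Q (~-sym (closed b (~-sym (bc Q)) (separated (ce Q) (ae Q))))
  ... | no _ | yes refl = ac Q (closed a (ab Q) (≢-sym (separated (ce Q) (ae Q))))
  ... | no a≢q | no b≢q = no-C₄ (ab Q) (bc Q) (ends-twins P (~-sym (bc Q)) b≢q) (~-sym (ends-twins P (ab Q) a≢q))
    (ac Q) (ae P) (≢-sym (separated (ce Q) (ae Q))) (separated (ab P) (≁-sym (be P)))

  does-true : {A : Set} (a? : Dec A) → does a? ≡ true → A
  does-true (yes a) _ = a

  -- Closedness forces the path `z w q p`. As `z` does not reach `p` and the ends are twins, `p` has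
  -- arcs to all counted out-neighbours of `z`, and also to `z`, which `Closed-end` shows to be
  -- counted.
  Chain-bound : Closed p q → ∀ n → Chain n p q → n ≤ measure p
  Chain-bound closed zero    _ = z≤n
  Chain-bound {p} {q} closed (suc n) (w , z , h@(_ , (wp , zq) , (_ , zp)) , c) with ≻⇒P₄ h
  ... | inj₁ P = contradiction (closed z (bc P) (⇒⇒≢ zq)) (⇒⇒≁ zq)
  ... | inj₂ P = ≤-trans (s≤s (Chain-bound closed′ n (Chain-swap n c)))
          (count-strict {p = λ x → does (measured? z x)} {λ x → does (measured? p x)} included z
            (dec-false (measured? z z) (⇒-irrefl ∘ proj₁))
            (dec-true (measured? p z) (p⇒z , Closed-end P closed′)))
    where
    closed′ : Closed z w
    closed′ y yz y≢w = middles-twins′ P (closed y (ends-twins P yz y≢w) (λ { refl → ⇐⇒≁ zq yz })) y≢w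
      (λ { refl → ae P (~-sym yz) })
    dominated : ∀ x → x ≢ q → z ⇒ x → p ⇒ x
    dominated x x≢q zx with position p x
    ... | equal refl = contradiction zx (proj₁ zp)
    ... | forward px = px
    ... | back xp    = contradiction xp (proj₂ zp x zx)
    ... | missing px = contradiction (ends-twins′ P (~-sym px) x≢q) (⇐⇒≁ zx)
    p⇒z : p ⇒ z
    p⇒z with position p z
    ... | equal refl = contradiction (ab P) (be P ∘ ~-sym)
    ... | forward pz = pz
    ... | back zp′   = contradiction zp′ (proj₁ zp)
    ... | missing pz = contradiction (~-sym pz) (ae P)
    included : ∀ x → does (measured? z x) ≡ true → does (measured? p x) ≡ true
    included x mx with does-true (measured? z x) mx
    -- The out-neighbour `q` of `z` is adjacent to `p` in the missing graph, but it is a middle and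
    -- therefore not counted.
    ... | zx , ¬mid = dec-true (measured? p x) (dominated x (λ { refl → ¬mid (_ , _ , _ , reverse P) }) zx , ¬mid)

  -- If some `y` completes the path to a pentagon, four losers determine the cycle; if none does,
  -- the chain is longer than `measure p`, which is at most `m`.
  long-chain : P₄ p q r t → (p , q) ≻ (r , t) → Chain (4 + suc m) p q → ∃ λ y → Cycle p q r t y
  long-chain {p} {q} {r} {t} P h c with any? (λ y → (y ~? p) ×-dec ¬? (y ≟ q) ×-dec ¬? (y ~? q))
  ... | yes (y , yp , y≢q , yq) = y , C₅-chain
    (pentagon P (ends-twins P yp y≢q) yp yq (λ yr → yq (middles-twins′ P yr y≢q (λ { refl → ae P (~-sym yp) }))))
    h (Chain-take 4 c)
  ... | no ¬open = contradiction (Chain-bound closed (4 + suc m) c) (<⇒≱ (s≤s (≤-trans (count-≤ _) (m≤n+m m 4))))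
    where
    closed : Closed p q
    closed y yp y≢q = decidable-stable (y ~? q) (λ yq → ¬open (y , yp , y≢q , yq))

  -- Orienting the missing edges

  Unreachable? : ∀ w v → Dec (Unreachable w v)
  Unreachable? w v = ¬? (w ⇒? v) ×-dec all? (λ y → (w ⇒? y) →-dec ¬? (y ⇒? v))

  ≻? : ∀ a b u v → Dec ((a , b) ≻ (u , v))
  ≻? a b u v = ((a ~? b) ×-dec (u ~? v)) ×-dec ((a ⇒? u) ×-dec (b ⇒? v)) ×-dec Unreachable? a v ×-dec Unreachable? b u

  Beaten : V → V → Set
  Beaten u v = ∃₂ λ w z → (w , z) ≻ (u , v)

  beaten? : ∀ u v → Dec (Beaten u v)
  beaten? u v = any? λ w → any? λ z → ≻? w z u v

  active? : ∀ a b → Dec (Active a b)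
  active? a b = any? λ u → any? λ v → ≻? a b u v

  violates? : ∀ u v w → Dec (Violates u v w)
  violates? u v w = (w ⇒? u) ×-dec Unreachable? w v

  justified? : ∀ u v → Dec (Justified u v)
  justified? u v = all? λ w → violates? u v w →-dec any? λ z → ≻? w z u v

  prefers? : ∀ x b → Dec (Prefers x b)
  prefers? x b = any? λ a → (active? a b ×-dec justified? a b) ×-dec Unreachable? a x ×-dec ¬? (a ≟ x)

  Clean : V → V → Set
  Clean u v = ¬ ∃ (Violates u v)

  clean? : ∀ u v → Dec (Clean u v)
  clean? u v = ¬? (any? (violates? u v))

  -- On a cycle of the losing relation all violator sets are nonempty and there is no
  -- edge to start from; Leading is an orientation that is constant along the cycle.
  Leading : V → V → Set
  Leading u v = ∃₂ λ r t → (u , v) ≻ (r , t) × v ~ r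

  leading? : ∀ u v → Dec (Leading u v)
  leading? u v = any? λ r → any? λ t → ≻? u v r t ×-dec (v ~? r)

  compare : Bool → Bool → Bool → Bool
  compare true  false _   = true
  compare false true  _   = false
  compare true  true  tie = tie
  compare false false tie = tie

  compare-not : ∀ a b tie → compare b a (not tie) ≡ not (compare a b tie)
  compare-not true  true  _ = refl
  compare-not true  false _ = refl
  compare-not false true  _ = refl
  compare-not false false _ = refl

  compare-false : ∀ a {tie} → tie ≡ false → compare a true tie ≡ false
  compare-false true  tie-false = tie-false
  compare-false false _         = refl

  smaller : V → V → Bool
  smaller u v = toℕ u <ᵇ toℕ v

  smaller-not : u ≢ v → smaller v u ≡ not (smaller u v)
  smaller-not {u} {v} u≢v = go (toℕ u) (toℕ v) (u≢v ∘ toℕ-injective)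
    where
    go : ∀ k l → k ≢ l → (l <ᵇ k) ≡ not (k <ᵇ l)
    go zero    zero    k≢l = contradiction refl k≢l
    go zero    (suc l) k≢l = refl
    go (suc k) zero    k≢l = refl
    go (suc k) (suc l) k≢l = go k l (k≢l ∘ cong suc)

  preferred : V → V → Bool
  preferred u v = compare (does (prefers? u v)) (does (prefers? v u)) (smaller u v)

  -- Cleanness decides first, then `preferred`, which itself falls back on the numbering of the
  -- vertices.
  convenient : V → V → Bool
  convenient u v = compare (does (clean? u v)) (does (clean? v u)) (preferred u v)

  convenient-not : u ≢ v → convenient v u ≡ not (convenient u v)
  convenient-not {u} {v} u≢v = trans (cong (compare _ _) (trans (cong (compare _ _) (smaller-not u≢v))
    (compare-not (does (prefers? u v)) _ _))) (compare-not (does (clean? u v)) _ _)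

  -- Walks back along at most `n` losing edges and copies the orientation of the unbeaten edge it
  -- meets; `Leading` serves the five-cycles, where the walk never ends.
  orient : ℕ → V → V → Bool
  orient zero    u v = compare (does (leading? u v)) (does (leading? v u)) (smaller u v)
  orient (suc n) u v with beaten? u v
  ... | yes (w , z , _) = orient n w z
  ... | no  _           = convenient u v

  orient-beaten : ∀ n → (w , z) ≻ (u , v) → orient (suc n) u v ≡ orient n w z
  orient-beaten {u = u} {v} n h with beaten? u v
  ... | yes (w′ , z′ , h′) with ≻-injective h h′
  ...   | refl , refl = refl
  orient-beaten n h | no ¬beaten = contradiction (_ , _ , h) ¬beaten

  orient-unbeaten : ∀ n → ¬ Beaten u v → orient (suc n) u v ≡ convenient u v
  orient-unbeaten {u} {v} n ¬beaten with beaten? u v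
  ... | yes beaten = contradiction beaten ¬beaten
  ... | no  _      = refl

  orient-not : ∀ n → u ≢ v → orient n v u ≡ not (orient n u v)
  orient-not {u} {v} zero u≢v = trans (cong (compare _ _) (smaller-not u≢v)) (compare-not (does (leading? u v)) _ _)
  orient-not {u} {v} (suc n) u≢v = case beaten? u v of λ where
    (yes (w , z , h)) → trans (orient-beaten n (≻-swap h))
      (trans (orient-not n (~⇒≢ (proj₁ (proj₁ h)))) (cong not (sym (orient-beaten n h))))
    (no ¬beaten) → trans (orient-unbeaten n (λ (w , z , h) → ¬beaten (z , w , ≻-swap h)))
      (trans (convenient-not u≢v) (cong not (sym (orient-unbeaten n ¬beaten))))

  orient-stable : ∀ n → ¬ Chain n u v → orient n u v ≡ orient (suc n) u v
  orient-stable zero ¬chain = contradiction tt ¬chain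
  orient-stable {u} {v} (suc n) ¬chain = case beaten? u v of λ where
    (yes (w , z , h)) → trans (orient-beaten n h)
      (trans (orient-stable n (λ c → ¬chain (w , z , h , c))) (sym (orient-beaten (suc n) h)))
    (no ¬beaten) → trans (orient-unbeaten n ¬beaten) (sym (orient-unbeaten (suc n) ¬beaten))

  orient-cycle : ∀ n → Cycle p q r t y → orient n p q ≡ true
  orient-cycle {p} {q} zero C
    rewrite dec-true (leading? p q) (_ , _ , Cycle.lose₀ C , P₄.bc (C₅.pqrt (Cycle.rim C)))
          -- The pair `q p` loses only to `t r`, and leading would need `p ~ t`.
          | dec-false (leading? q p) λ (r′ , t′ , h , pr′) →
              case ≻-functional (Cycle.lose₀ C) (≻-swap h) of λ { (refl , refl) → ae (C₅.pqrt (Cycle.rim C)) pr′ } = refl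
  orient-cycle (suc n) C = trans (orient-beaten n (Cycle.lose₄ C)) (orient-cycle n (Cycle-previous C))

  -- One step more than the chain length in `long-chain`, because `arrow-≻` spends one step.
  arrow : V → V → Bool
  arrow = orient (5 + suc m)

  arrow-not : u ≢ v → arrow v u ≡ not (arrow u v)
  arrow-not = orient-not (5 + suc m)

  -- The value at `uv` is that at `wz` with one step fewer. This matters only when a chain of
  -- `4 + suc m` losers leads to `wz`, and then both edges lie on a five-cycle. Arguing by double
  -- negation avoids deciding `Chain`.
  arrow-≻ : (w , z) ≻ (u , v) → arrow w z ≡ arrow u v
  arrow-≻ {w} {z} {u} {v} h = decidable-stable (arrow w z Bool.≟ arrow u v) λ arrow≢ → arrow≢
    (trans (sym (orient-stable (4 + suc m) (arrow≢ ∘ cyclic))) (sym (orient-beaten (4 + suc m) h)))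
    where
    cyclic : Chain (4 + suc m) w z → arrow w z ≡ arrow u v
    cyclic c with ≻⇒P₄ h
    ... | inj₁ P = let _ , C = long-chain P h c in
      trans (orient-cycle (5 + suc m) C) (sym (orient-cycle (5 + suc m) (Cycle-next C)))
    ... | inj₂ P = let _ , C = long-chain P (≻-swap h) (Chain-swap (4 + suc m) c) in
      trans (arrow-not (~⇒≢ (P₄.ab P))) (trans (cong not
        (trans (orient-cycle (5 + suc m) C) (sym (orient-cycle (5 + suc m) (Cycle-next C)))))
        (sym (arrow-not (~⇒≢ (ce P)))))

  -- If both orientations have violators, these form a losing edge. Otherwise a violator of `u v`
  -- leaves `v u` as the only clean orientation of an unbeaten edge, and `convenient` chooses it.
  arrow-justified : u ~ v → arrow u v ≡ true → Justified u v
  arrow-justified {u} {v} uv arrow-uv w viol with any? (violates? v u)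
  ... | yes (z , viol′) = z , violators-lose uv viol viol′
  ... | no clean = case trans (sym arrow-uv) (trans (orient-unbeaten (4 + suc m) unbeaten) inconvenient) of λ ()
    where
    unbeaten : ¬ Beaten u v
    unbeaten (_ , z , h) = clean (z , proj₂ (loser-violates h))
    inconvenient : convenient u v ≡ false
    inconvenient = cong₂ (λ a b → compare a b (preferred u v))
      (dec-false (clean? u v) (λ clean′ → clean′ (w , viol))) (dec-true (clean? v u) clean)

  -- By `no-violator` the orientation `x b` is clean, so the edge is unbeaten; if `b x` is clean as
  -- well, `Prefers x b` breaks the tie.
  arrow-inward : (a , b) ≻ (u , v) → Justified a b → Unreachable a x → x ≢ a → x ~ b →
    P₄ a b u v ⊎ P₄ b a v u × x ~ a → arrow b x ≡ false
  arrow-inward {a} {b} {u} {v} {x} h just ax x≢a xb type =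
    trans (orient-unbeaten (4 + suc m) (λ (_ , z , k) → clean (z , proj₂ (loser-violates k)))) inconvenient
    where
    clean : Clean x b
    clean (w , viol) = no-violator h just ax x≢a xb type viol
    prefers : Prefers x b
    prefers = a , ((u , v , h) , just) , ax , ≢-sym x≢a
    inconvenient : convenient b x ≡ false
    inconvenient = trans (cong (λ c → compare (does (clean? b x)) c (preferred b x)) (dec-true (clean? x b) clean))
      (compare-false (does (clean? b x)) (cong₂ (λ p q → compare p q (smaller b x))
        (dec-false (prefers? b x) (preferences-exclude (~-sym xb) prefers)) (dec-true (prefers? x b) prefers)))

  -- The feed vertex of a median order of the oriented completion

  completion : V → V → Bool
  completion u v = d u v ∨ (missingᵇ d u v ∧ arrow u v)

  completion-⇒ : u ⇒ v → completion u v ≡ true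
  completion-⇒ {u} {v} uv = cong (_∨ (missingᵇ d u v ∧ arrow u v)) uv

  completion-~ : u ~ v → completion u v ≡ arrow u v
  completion-~ {u} {v} uv = cong₂ _∨_ (¬-not (~⇒⇏ uv)) (cong (_∧ arrow u v) (missing-edge uv))

  completion-⇐ : v ⇒ u → completion u v ≡ false
  completion-⇐ {v} {u} vu = cong₂ _∨_ (no2cycle v u vu) (cong (_∧ arrow u v) (¬-not (⇐⇒≁ vu ∘ edge)))

  completion-not : u ≢ v → completion v u ≡ not (completion u v)
  completion-not {u} {v} u≢v with position u v
  ... | equal u≡v  = contradiction u≡v u≢v
  ... | forward uv = trans (completion-⇐ uv) (cong not (sym (completion-⇒ uv)))
  ... | back vu    = trans (completion-⇒ vu) (cong not (sym (completion-⇐ vu)))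
  ... | missing uv = trans (completion-~ (~-sym uv)) (trans (arrow-not u≢v) (cong not (sym (completion-~ uv))))

  completion-arc : completion u v ≡ true → u ⇒ v ⊎ u ~ v × arrow u v ≡ true
  completion-arc {u} {v} uv with position u v
  ... | equal refl  = case trans (sym uv) (cong₂ _∨_ (noLoop u) (cong (_∧ arrow u u) (missing-irrefl u))) of λ ()
  ... | forward u⇒v = inj₁ u⇒v
  ... | back v⇒u    = case trans (sym uv) (completion-⇐ v⇒u) of λ ()
  ... | missing u~v = inj₂ (u~v , trans (sym (completion-~ u~v)) uv)

  second-out : ¬ u ⇒ v → u ⇒ y → y ⇒ v → inSecondOut d u v ≡ true
  second-out {u} {v} {y} uv uy yv = cong₂ _∧_ (cong not (¬-not uv)) (anyFin-true (λ x → d u x ∧ d x v) y (cong₂ _∧_ uy yv))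

  module _ (f : V) where

    -- Missing edges at the feed may be turned towards it, except those that lose: each
    -- retained out-neighbour pays for the second out-neighbour that its edge creates.
    Retained : V → Set
    Retained y = (f ~ y × arrow f y ≡ true) × Active f y

    retained? : ∀ y → Dec (Retained y)
    retained? y = ((f ~? y) ×-dec (arrow f y Bool.≟ true)) ×-dec active? f y

    retained second : V → Bool
    retained y = does (retained? y)
    second = inSecondOut d f

    -- With `Second⁺`, the first and second out-neighbourhoods of `f` once its missing edges that
    -- are not retained have been turned towards it.
    out⁺ : V → Bool
    out⁺ u = d f u ∨ retained u

    Second⁺ : V → Set
    Second⁺ v = (out⁺ v ≡ false × v ≢ f) × ∃ λ y → out⁺ y ≡ true × completion y v ≡ true

    second⁺? : ∀ v → Dec (Second⁺ v)
    second⁺? v = ((out⁺ v Bool.≟ false) ×-dec ¬? (v ≟ f)) ×-dec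
      any? λ y → (out⁺ y Bool.≟ true) ×-dec (completion y v Bool.≟ true)

    out⁺-cases : out⁺ u ≡ true → f ⇒ u ⊎ Retained u
    out⁺-cases {u} h = [ inj₁ , inj₂ ∘ does-true (retained? u) ]′ (∨-true h)

    out⁺-false : out⁺ u ≡ false → ¬ f ⇒ u × retained u ≡ false
    out⁺-false h = let fu , ru = ∨-false h in (λ fu′ → case trans (sym fu′) fu of λ ()) , ru

    out⁺-completion : out⁺ u ≡ true → completion f u ≡ true
    out⁺-completion h with out⁺-cases h
    ... | inj₁ fu                  = completion-⇒ fu
    ... | inj₂ ((fu , arr) , _) = trans (completion-~ fu) arr

    out⁺-f : out⁺ f ≡ false
    out⁺-f = ¬-not λ h → case out⁺-cases h of λ where
      (inj₁ ff)             → ⇒-irrefl ff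
      (inj₂ ((ff , _) , _)) → ~⇒≢ ff refl

    out⁺-≢ : ∀ {u w} → out⁺ u ≡ true → out⁺ w ≡ false → u ≢ w
    out⁺-≢ hu hw refl = case trans (sym hu) hw of λ ()

    open MedianOrder completion

    -- The order is still median for `completion`: turning edges towards `f` only shrinks the set
    -- that `f` must dominate. Any other `w` here receives no arc from `out⁺`, hence dominates it.
    second⁺-dominates : ∀ w → out⁺ w ≡ false → does (second⁺? w) ≡ false → Dominates out⁺ w
    second⁺-dominates w ¬w ¬second u hu = case w ≟ f of λ where
        (yes refl) → out⁺-completion hu , trans (completion-not (≢-sym (out⁺-≢ hu ¬w))) (cong not (out⁺-completion hu))
        (no w≢f)   → trans (completion-not (out⁺-≢ hu ¬w)) (cong not (unreached w≢f)) , unreached w≢f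
      where
      unreached : w ≢ f → completion u w ≡ false
      unreached w≢f = ¬-not λ uw →
        case trans (sym ¬second) (dec-true (second⁺? w) ((¬w , w≢f) , u , hu , uw)) of λ ()

    Created : V → V → Set
    Created y v = ∃ λ u → (f , y) ≻ (u , v)

    -- The case of a five-cycle y f t r v of missing edges; here the retained y is also a
    -- second out-neighbour of f in d, which pays for v.
    Exceptional : V → V → Set
    Exceptional y v = (v ~ y × v ≁ f × v ≢ f) × ∃₂ λ r t → (f , y) ≻ (r , t) × P₄ y f t r

    created? : ∀ v → Dec (∃ λ y → retained y ≡ true × Created y v)
    created? v = any? λ y → (retained y Bool.≟ true) ×-dec any? λ u → ≻? f y u v

    exceptional? : ∀ v → Dec (∃ λ y → retained y ≡ true × Exceptional y v)
    exceptional? v = any? λ y → (retained y Bool.≟ true) ×-dec ((v ~? y) ×-dec ¬? (v ~? f) ×-dec ¬? (v ≟ f)) ×-dec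
      any? λ r → any? λ t → ≻? f y r t ×-dec P₄? y f t r

    Exceptional-functional : Exceptional y v → Exceptional y v′ → v ≡ v′
    Exceptional-functional {y} {v} {v′} ((vy , vf , v≢f) , r , t , h , P) ((v′y , v′f , v′≢f) , _) =
      decidable-stable (v ≟ v′) λ v≢v′ → v′f (middles-twins
        (path vy (P₄.ab P) (bc P) vf (λ vt → vf (middles-twins′ P vt v≢f (~⇒≢ (ends-twins P vy v≢f)))) (ac P))
        v′y (≢-sym v≢v′) v′≢f)

    created-count : count (λ v → does (created? v)) ≤ count retained
    created-count = count-image {F = Created} (λ (_ , h) (_ , h′) → proj₂ (≻-functional h h′))
      (λ v → does-true (created? v))

    exceptional-count : count (λ v → does (exceptional? v)) ≤ count (λ y → retained y ∧ second y)
    exceptional-count = count-image {F = Exceptional} Exceptional-functional λ v hv →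
      let y , ry , ex = does-true (exceptional? v) hv in y , cong₂ _∧_ ry (compensated ex) , ex
      where
      -- The ends `y` and `r` of the path are not adjacent and `y` does not reach `r`, so `r ⇒ y`
      -- remains and `f ⇒ r ⇒ y` is a path.
      compensated : Exceptional y v → second y ≡ true
      compensated {y} (_ , r , t , ((fy , _) , (fr , _) , _ , yr) , P) with position y r
      ... | equal refl = contradiction fr (~⇒⇏ fy)
      ... | forward y⇒r = contradiction y⇒r (proj₁ yr)
      ... | back r⇒y    = second-out (~⇒⇏ fy) fr r⇒y
      ... | missing y~r = contradiction y~r (ae P)

    second⁺-cases : Second⁺ v → second v ≡ true ⊎
      does (created? v) ≡ true ⊎ does (exceptional? v) ≡ true
    second⁺-cases {v} ((¬v , v≢f) , y , hy , yv) with any? (λ x → (f ⇒? x) ×-dec (x ⇒? v))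
    ... | yes (x , fx , xv) = inj₁ (second-out (proj₁ (out⁺-false ¬v)) fx xv)
    ... | no ¬path = inj₂ (classify (out⁺-cases hy) (completion-arc yv))
      where
      fv : Unreachable f v
      fv = proj₁ (out⁺-false ¬v) , λ x fx xv → ¬path (x , fx , xv)
      classify : f ⇒ y ⊎ Retained y → y ⇒ v ⊎ y ~ v × arrow y v ≡ true →
        does (created? v) ≡ true ⊎ does (exceptional? v) ≡ true
      classify (inj₁ fy) (inj₁ y⇒v) = contradiction y⇒v (proj₂ fv y fy)
      -- Here `f` violates `y v`, so some edge `fz` loses to `yv`, and `arrow-≻` makes `z` retained.
      classify (inj₁ fy) (inj₂ (y~v , arr)) with arrow-justified y~v arr f (fy , fv)
      ... | z , h = inj₁ (dec-true (created? v) (z ,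
        dec-true (retained? z) ((proj₁ (proj₁ h) , trans (arrow-≻ h) arr) , y , v , h) , y , h))
      -- The losing relation persists with `v` in place of `v₀`, since `uv` can only be a missing
      -- edge.
      classify (inj₂ ret@((fy , _) , u , v₀ , ((_ , uv₀) , (fu , yv₀) , fv₀ , yu))) (inj₁ y⇒v) =
        inj₁ (dec-true (created? v) (y , dec-true (retained? y) ret , u , ((fy , u~v) , (fu , y⇒v) , fv , yu)))
        where
        u~v : u ~ v
        u~v with position u v
        ... | equal refl  = contradiction fu (proj₁ fv)
        ... | forward u⇒v = contradiction u⇒v (proj₂ fv u fu)
        ... | back v⇒u    = contradiction v⇒u (proj₂ yu v y⇒v)
        ... | missing u~v = u~v
      -- The arrow from `y` to `v` contradicts `arrow-inward` unless the path is `y f v₀ u` and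
      -- `v ≁ f`, which is the five-cycle.
      classify (inj₂ ret@((fy , arr) , u , v₀ , h)) (inj₂ (y~v , arr′)) = case ≻⇒P₄ h of λ where
          (inj₁ P) → inward (inj₁ P)
          (inj₂ P) → case v ~? f of λ where
            (yes v~f) → inward (inj₂ (P , v~f))
            (no  v≁f) → inj₂ (dec-true (exceptional? v) (y , dec-true (retained? y) ret ,
              (~-sym y~v , v≁f , v≢f) , u , v₀ , h , P))
        where
        inward : ∀ {A : Set} → P₄ f y u v₀ ⊎ P₄ y f v₀ u × v ~ f → A
        inward type = case trans (sym arr′)
          (arrow-inward h (arrow-justified fy arr) fv v≢f (~-sym y~v) type) of λ ()

    -- The bound on `out⁺` from the median order is padded with `rest`: a retained vertex that is
    -- also in `second` lies outside `second⁺`, so it is free to pay for an exceptional vertex,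
    -- while `retained` pays for the created ones.
    feed-satisfies : ∀ {ys} → Median (f ∷ ys) → f ∷ ys ↭ allFin m → outdeg d f ≤ secondOutdeg d f
    feed-satisfies {ys} med ρ = +-cancelʳ-≤ (count retained + rest) (count (d f)) (count second) (begin
      count (d f) + (count retained + rest)         ≡⟨ solve 3 (λ a b c → a :+ (b :+ c) := (a :+ (b :+ con 0)) :+ c) refl
                                                         (count (d f)) (count retained) rest ⟩
      counts (d f ∷ retained ∷ []) + rest           ≤⟨ +-mono-≤
                                                         (counts-mono (d f ∷ retained ∷ []) (out⁺ ∷ []) disjoint) ≤-refl ⟩
      counts (out⁺ ∷ []) + rest                     ≤⟨ +-mono-≤ (+-mono-≤ feed ≤-refl) ≤-refl ⟩
      counts (second⁺ ∷ []) + rest                  ≡⟨ solve 2 (λ a b → (a :+ con 0) :+ b := a :+ (b :+ con 0)) refl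
                                                         (count second⁺) rest ⟩
      counts (second⁺ ∷ retained-second ∷ [])       ≤⟨ counts-mono
                                                         (second⁺ ∷ retained-second ∷ []) (second ∷ created ∷ exceptional ∷ []) covered ⟩
      counts (second ∷ created ∷ exceptional ∷ [])  ≤⟨ +-monoʳ-≤ (count second) (+-mono-≤ created-count
                                                         (≤-trans (≤-reflexive (+-identityʳ _)) exceptional-count)) ⟩
      count second + (count retained + rest)        ∎)
      where
      open ≤-Reasoning
      open +-*-Solver
      second⁺ created exceptional retained-second : V → Bool
      second⁺ v = does (second⁺? v)
      created v = does (created? v)
      exceptional v = does (exceptional? v)
      retained-second v = retained v ∧ second v
      rest : ℕ
      rest = count retained-second
      feed : count out⁺ ≤ count second⁺
      feed = subst₂ _≤_ (trans (tally-↭ out⁺ ρ) (sym (count≡tally out⁺)))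
        (trans (tally-↭ second⁺ ρ) (sym (count≡tally second⁺)))
        (feed-bound second⁺-dominates out⁺-f (dec-false (second⁺? f) λ ((_ , f≢f) , _) → f≢f refl) med)
      disjoint : ∀ v → 𝟙 (d f v) + (𝟙 (retained v) + 0) ≤ 𝟙 (out⁺ v) + 0
      disjoint v = 𝟙-disjoint (λ fv → dec-false (retained? v) λ ((f~v , _) , _) → ~⇒⇏ f~v fv)
      covered : ∀ v → 𝟙 (second⁺ v) + (𝟙 (retained-second v) + 0) ≤ 𝟙 (second v) + (𝟙 (created v) + (𝟙 (exceptional v) + 0))
      covered v = go (second⁺? v)
        where
        go : (h? : Dec (Second⁺ v)) →
          𝟙 (does h?) + (𝟙 (retained-second v) + 0) ≤ 𝟙 (second v) + (𝟙 (created v) + (𝟙 (exceptional v) + 0))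
        go (no _)  = ≤-trans (≤-reflexive (+-identityʳ _))
          (≤-trans (𝟙-mono (proj₂ ∘ ∧-true {retained v} {second v})) (m≤m+n _ _))
        go (yes h) = ≤-trans
          (≤-reflexive (cong (λ b → 1 + (𝟙 (b ∧ second v) + 0)) (proj₂ (out⁺-false (proj₁ (proj₁ h))))))
          (case second⁺-cases h of λ where
            (inj₁ s)        → ≤-trans (𝟙-mono {true} (λ _ → s)) (m≤m+n _ _)
            (inj₂ (inj₁ c)) → ≤-trans (𝟙-mono {true} (λ _ → c)) (≤-trans (m≤m+n _ _) (m≤n+m _ (𝟙 (second v))))
            (inj₂ (inj₂ x)) → ≤-trans (𝟙-mono {true} (λ _ → x))
              (≤-trans (m≤m+n _ 0) (≤-trans (m≤n+m _ (𝟙 (created v))) (m≤n+m _ (𝟙 (second v))))))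

  second-neighbourhood : V → ∃ λ v → outdeg d v ≤ secondOutdeg d v
  second-neighbourhood v with MedianOrder.median completion (allFin m)
  ... | []     , ρ , _   = case subst (v ∈_) (↭-empty-inv (↭-sym ρ)) (∈-allFin v) of λ ()
  ... | f ∷ ys , ρ , med = f , feed-satisfies f med ρ

mainTheorem1 : ∀ {n} (G : Graph n) → IsSimple G →
    ¬ InducedSub C4 G → ¬ InducedSub (complement C4) G → ¬ InducedSub S3 G →
    ¬ InducedSub chair G → ¬ InducedSub (complement chair) G →
    ∀ {m} (D : Digraph (suc m)) → IsOriented D → MissingGraph D G →
    ∃ λ (v : Fin (suc m)) → outdeg D v ≤ secondOutdeg D v
mainTheorem1 G _ C₄-free 2K₂-free S₃-free chair-free co-chair-free D oriented missing =
  SecondNeighbourhood.second-neighbourhood D oriented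
    (in-missing (from-yes (all? λ i → any? λ j → C4 i j Bool.≟ true)) C₄-free)
    (in-missing (from-yes (all? λ i → any? λ j → complement C4 i j Bool.≟ true)) 2K₂-free)
    (in-missing (from-yes (all? λ i → any? λ j → S3 i j Bool.≟ true)) S₃-free)
    (in-missing (from-yes (all? λ i → any? λ j → chair i j Bool.≟ true)) chair-free)
    (in-missing (from-yes (all? λ i → any? λ j → complement chair i j Bool.≟ true)) co-chair-free)
    zero
  where
  in-missing : ∀ {k} {H : Graph k} → (∀ i → ∃ λ j → H i j ≡ true) → ¬ InducedSub H G → ¬ InducedSub H (missingᵇ D)
  in-missing = neighbours-in-missing {D = D} {G} missing
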